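{- For every prime $p>2$ there is no minion homomorphism $\mathcal V_2\text{ - }\mathbb Z_p\to\mathcal Z_{p^2}$.
   Context: A minion $\mathcal R$ is a functor from finite sets to sets: it assigns a set $\mathcal R^{(D)}$ to each finite set $D$ and a map $\mathcal R^{(\alpha)}:\mathcal R^{(D)}\to\mathcal R^{(E)}$ to each function $\alpha:D\to E$ between finite sets, preserving identities and composition. A minion homomorphism $\xi:\mathcal R\to\mathcal S$ is a natural transformation: a family of functions $\xi^{(D)}:\mathcal R^{(D)}\to\mathcal S^{(D)}$ with $\xi^{(E)}\circ\mathcal R^{(\alpha)}=\mathcal S^{(\alpha)}\circ\xi^{(D)}$ for every $\alpha:D\to E$. For $m\in\mathbb N$, the minion $\mathcal Z_m$ is given by $\mathcal Z_m^{(D)}=\{f:D\to\mathbb Z_m\mid\sum_{a\in D}f(a)=1\}$ (where $\mathbb Z_m$ is the ring of integers modulo $m$), and for $\alpha:D\to E$, $\mathcal Z_m^{(\alpha)}(f)(b)=\sum_{a\in\alpha^{ -1}(b)}f(a)$. For a prime $p$, the minion $\mathcal V_2\text{ - }\mathbb Z_p$ is defined as follows; all computations are in the field $\mathbb Z_p$. For vectors in $\mathbb Z_p^N$ let $\mathfrak w(v_1,\dots,v_N)=v_1+\cdots+v_N$ and let $\odot$ denote the componentwise product. For a finite set $D$, $(\mathcal V_2\text{ - }\mathbb Z_p)^{(D)}$ is the set of triples $(V,\mathbf i,\mathbf v)$ where $V$ is a linear subspace of $\mathbb Z_p^N$ for some $N\in\mathbb N$, $\mathbf i\in V$, and $\mathbf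 v:D\to V$, such that: (i) $\mathbf i=(1,1,\dots,1)$ and $\mathfrak w(\mathbf i)=1$; (s) $\sum_{a\in D}\mathbf v(a)=\mathbf i$; (o) $\mathfrak w(\mathbf v(a)\odot\mathbf v(b))=0$ for all $a\ne b$ in $D$; (p) $\mathfrak w(\mathbf v(a)\odot\mathbf v(a))=\mathfrak w(\mathbf v(a))$ for all $a\in D$. For $\alpha:D\to E$, $(\mathcal V_2\text{ - }\mathbb Z_p)^{(\alpha)}(V,\mathbf i,\mathbf v)=(V,\mathbf i,\mathbf v')$ with $\mathbf v'(b)=\sum_{a\in\alpha^{ -1}(b)}\mathbf v(a)$. -}

module Defs where

open import Algebra.Bundles using (CommutativeMonoid; CommutativeRing)
import Algebra.Construct.Pointwise as Pointwise
import Algebra.Properties.CommutativeMonoid.Sum as Sum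
import Algebra.Properties.Semiring.Sum as SemiringSum
open import Data.Bool.Base using (if_then_else_)
open import Data.Empty using (⊥-elim)
open import Data.Fin.Base using (Fin; zero; suc)
import Data.Fin.Properties as Fin
open import Data.Integer.Base as ℤ using (ℤ; +_)
open import Data.Integer.Divisibility.Signed using (_∣_; divides; ∣m∣n⇒∣m+n; ∣m⇒∣-m; ∣n⇒∣m*n)
import Data.Integer.Properties as ℤ
open import Data.Integer.Solver using (module +-*-Solver)
open import Data.Nat.Base using (ℕ; zero; suc)
open import Data.Product using (Σ; Σ-syntax; _×_; _,_; proj₁; proj₂)
open import Function.Base using (id; _∘_)
open import Function.Bundles using (Func; _↔_; Inverse)
open import Function.Properties.Inverse using (Inverse⇒Injection)
open import Level using (Level; 0ℓ; _⊔_) renaming (suc to lsuc)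
open import Relation.Binary.Bundles using (Setoid)
open import Relation.Binary.Definitions using (DecidableEquality)
open import Relation.Binary.PropositionalEquality as ≡ using (_≡_; _≢_; _≗_)
import Relation.Binary.Reasoning.Setoid as SetoidReasoning
open import Relation.Nullary.Decidable using (Dec; yes; no; does; via-injection)
open import Relation.Nullary.Negation using (¬_)
open import Relation.Unary using (Pred; _∈_; _≐_)

private variable
  c ℓ c′ ℓ′ : Level

record FinSet : Set₁ where
  field
    Elem  : Set
    size  : ℕ
    enum  : Elem ↔ Fin size

  open Inverse enum public using (strictlyInverseˡ; strictlyInverseʳ)
    renaming (to to index; from to element)

  infix 4 _≟_
  _≟_ : DecidableEquality Elem
  _≟_ = via-injection (Inverse⇒Injection enum) Fin._≟_

open FinSet using (Elem)

-- Minions.  Sets are setoids, and equality of functions between finite sets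
-- is pointwise; `map-cong` says that the action on functions is well defined
-- for that equality.
record Minion (c ℓ : Level) : Set (lsuc (lsuc 0ℓ ⊔ c ⊔ ℓ)) where
  field
    obj : FinSet → Setoid c ℓ
    map : ∀ D E → (Elem D → Elem E) → Func (obj D) (obj E)

  Obj : FinSet → Set c
  Obj D = Setoid.Carrier (obj D)

  Eq : ∀ D → Obj D → Obj D → Set ℓ
  Eq D = Setoid._≈_ (obj D)

  act : ∀ D E → (Elem D → Elem E) → Obj D → Obj E
  act D E α = Func.to (map D E α)

  field
    map-cong : ∀ D E {α β : Elem D → Elem E} → α ≗ β →
               ∀ x → Eq E (act D E α x) (act D E β x)
    map-id   : ∀ D x → Eq D (act D D id x) x
    map-∘    : ∀ D E F (β : Elem E → Elem F) (α : Elem D → Elem E) x →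
               Eq F (act D F (β ∘ α) x) (act E F β (act D E α x))

record MinionHom (R : Minion c ℓ) (S : Minion c′ ℓ′) : Set (lsuc 0ℓ ⊔ c ⊔ ℓ ⊔ c′ ⊔ ℓ′) where
  private
    module R = Minion R
    module S = Minion S
  field
    ξ : ∀ D → Func (R.obj D) (S.obj D)
    natural : ∀ D E (α : Elem D → Elem E) (x : R.Obj D) →
              S.Eq E (Func.to (ξ E) (R.act D E α x)) (S.act D E α (Func.to (ξ D) x))

module FinSum (M : CommutativeMonoid c ℓ) where
  open CommutativeMonoid M renaming (Carrier to A)
  private
    module Σ′ = Sum M
  open SetoidReasoning setoid

  ∑ : (D : FinSet) → (Elem D → A) → A
  ∑ D f = Σ′.sum (f ∘ FinSet.element D)

  when : ∀ {p} {P : Set p} → Dec P → A → A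
  when P? x = if does P? then x else ε

  -- The sum of f over the fibre α⁻¹(b), written as a sum over all of D in
  -- which the terms outside the fibre are replaced by the neutral element.
  fibreSum : (D E : FinSet) → (Elem D → Elem E) → (Elem D → A) → Elem E → A
  fibreSum D E α f b = ∑ D λ a → when (FinSet._≟_ E (α a) b) (f a)

  when-cong : ∀ {p} {P : Set p} (P? : Dec P) {x y} → (P → x ≈ y) → when P? x ≈ when P? y
  when-cong (yes p) eq = eq p
  when-cong (no _)  eq = refl

  when-yes : ∀ {p} {P : Set p} (P? : Dec P) {x} → P → when P? x ≈ x
  when-yes (yes _) p = refl
  when-yes (no ¬p) p = ⊥-elim (¬p p)

  when-no : ∀ {p} {P : Set p} (P? : Dec P) {x} → ¬ P → when P? x ≈ ε
  when-no (yes p) ¬p = ⊥-elim (¬p p)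
  when-no (no _)  ¬p = refl

  when-ε : ∀ {p} {P : Set p} (P? : Dec P) {x} → (P → x ≈ ε) → when P? x ≈ ε
  when-ε (yes p) eq = eq p
  when-ε (no _)  eq = refl

  sum-ε : ∀ {n} (t : Fin n → A) → (∀ i → t i ≈ ε) → Σ′.sum t ≈ ε
  sum-ε {n} t eq = trans (Σ′.sum-cong-≋ eq) (Σ′.sum-replicate-zero n)

  sum-single : ∀ {n} (t : Fin n → A) i → (∀ j → j ≢ i → t j ≈ ε) → Σ′.sum t ≈ t i
  sum-single t zero eq =
    trans (∙-congˡ (sum-ε (t ∘ suc) λ j → eq (suc j) λ ())) (identityʳ _)
  sum-single t (suc i) eq =
    trans (∙-cong (eq zero λ ())
                  (sum-single (t ∘ suc) i λ j j≢i → eq (suc j) (j≢i ∘ Fin.suc-injective)))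
          (identityˡ _)

  ∑-cong : ∀ D {f g : Elem D → A} → (∀ a → f a ≈ g a) → ∑ D f ≈ ∑ D g
  ∑-cong D eq = Σ′.sum-cong-≋ (eq ∘ FinSet.element D)

  ∑-ε : ∀ D (f : Elem D → A) → (∀ a → f a ≈ ε) → ∑ D f ≈ ε
  ∑-ε D f eq = sum-ε _ (eq ∘ FinSet.element D)

  ∑-single : ∀ D (f : Elem D → A) a → (∀ b → b ≢ a → f b ≈ ε) → ∑ D f ≈ f a
  ∑-single D f a eq = begin
    ∑ D f                 ≈⟨ sum-single _ (D.index a) (λ j j≢i → eq _ λ e →
                               j≢i (≡.trans (≡.sym (D.strictlyInverseˡ j)) (≡.cong D.index e))) ⟩
    f (D.element (D.index a)) ≡⟨ ≡.cong f (D.strictlyInverseʳ a) ⟩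
    f a                   ∎
    where module D = FinSet D

  ∑-comm : ∀ D E (f : Elem D → Elem E → A) →
           ∑ D (λ a → ∑ E (f a)) ≈ ∑ E (λ b → ∑ D λ a → f a b)
  ∑-comm D E f = Σ′.∑-comm λ i j → f (FinSet.element D i) (FinSet.element E j)

  when-∑ : ∀ {p} {P : Set p} (P? : Dec P) D (f : Elem D → A) →
           when P? (∑ D f) ≈ ∑ D (when P? ∘ f)
  when-∑ (yes _) D f = refl
  when-∑ (no _)  D f = sym (∑-ε D _ λ _ → refl)

  fibreSum-cong : ∀ D E {α β : Elem D → Elem E} {f g : Elem D → A} →
                  α ≗ β → (∀ a → f a ≈ g a) →
                  ∀ b → fibreSum D E α f b ≈ fibreSum D E β g b
  fibreSum-cong D E {β = β} {f = f} {g} α≗β f≈g b = ∑-cong D λ a →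
    trans (reflexive (≡.cong (λ e → when (FinSet._≟_ E e b) (f a)) (α≗β a)))
          (when-cong (FinSet._≟_ E (β a) b) λ _ → f≈g a)

  fibreSum-id : ∀ D f b → fibreSum D D id f b ≈ f b
  fibreSum-id D f b =
    trans (∑-single D _ b λ a a≢b → when-no (FinSet._≟_ D a b) a≢b)
          (when-yes (FinSet._≟_ D b b) ≡.refl)

  fibreSum-∘ : ∀ D E F (β : Elem E → Elem F) (α : Elem D → Elem E) f k →
               fibreSum D F (β ∘ α) f k ≈ fibreSum E F β (fibreSum D E α f) k
  fibreSum-∘ D E F β α f k = sym (begin
    ∑ E (λ b → when (β b F.≟ k) (∑ D λ a → term b a))
      ≈⟨ ∑-cong E (λ b → when-∑ (β b F.≟ k) D (term b)) ⟩
    ∑ E (λ b → ∑ D λ a → when (β b F.≟ k) (term b a))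
      ≈⟨ ∑-comm E D (λ b a → when (β b F.≟ k) (term b a)) ⟩
    ∑ D (λ a → ∑ E λ b → when (β b F.≟ k) (term b a))
      ≈⟨ ∑-cong D {λ a → ∑ E λ b → when (β b F.≟ k) (term b a)} (λ a →
           ∑-single E (λ b → when (β b F.≟ k) (term b a)) (α a) λ b b≢ →
             when-ε (β b F.≟ k) λ _ → when-no (α a E.≟ b) (b≢ ∘ ≡.sym)) ⟩
    ∑ D (λ a → when (β (α a) F.≟ k) (term (α a) a))
      ≈⟨ ∑-cong D (λ a → when-cong (β (α a) F.≟ k) {term (α a) a} λ _ →
           when-yes (α a E.≟ α a) ≡.refl) ⟩
    ∑ D (λ a → when (β (α a) F.≟ k) (f a)) ∎)
    where
    module E = FinSet E
    module F = FinSet F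
    term : Elem E → Elem D → A
    term b a = when (α a E.≟ b) (f a)

  ∑-fibreSum : ∀ D E (α : Elem D → Elem E) f → ∑ E (fibreSum D E α f) ≈ ∑ D f
  ∑-fibreSum D E α f = begin
    ∑ E (λ b → ∑ D λ a → term b a)  ≈⟨ ∑-comm E D term ⟩
    ∑ D (λ a → ∑ E λ b → term b a)
      ≈⟨ ∑-cong D {λ a → ∑ E λ b → term b a} {f} (λ a →
           trans (∑-single E (λ b → term b a) (α a) λ b b≢ → when-no (α a E.≟ b) (b≢ ∘ ≡.sym))
                 (when-yes (α a E.≟ α a) ≡.refl)) ⟩
    ∑ D f ∎
    where
    module E = FinSet E
    term : Elem E → Elem D → A
    term b a = when (α a E.≟ b) (f a)

  ∑-closed : ∀ {p} (P : Pred A p) → P ε → (∀ {x y} → P x → P y → P (x ∙ y)) →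
             ∀ D f → (∀ a → P (f a)) → P (∑ D f)
  ∑-closed P Pε P∙ D f Pf = go _ (Pf ∘ FinSet.element D)
    where
    go : ∀ {n} (t : Fin n → A) → (∀ i → P (t i)) → P (Σ′.sum t)
    go {zero}  t Pt = Pε
    go {suc n} t Pt = P∙ (Pt zero) (go (t ∘ suc) (Pt ∘ suc))

  fibreSum-closed : ∀ {p} (P : Pred A p) → P ε → (∀ {x y} → P x → P y → P (x ∙ y)) →
                    ∀ D E (α : Elem D → Elem E) f → (∀ a → P (f a)) →
                    ∀ b → P (fibreSum D E α f b)
  fibreSum-closed P Pε P∙ D E α f Pf b = ∑-closed P Pε P∙ D _ λ a → go (FinSet._≟_ E (α a) b) (Pf a)
    where
    go : ∀ {q} {Q : Set q} (Q? : Dec Q) {x} → P x → P (when Q? x)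
    go (yes _) Px = Px
    go (no _)  Px = Pε

module SumHom (M : CommutativeMonoid c ℓ) (M′ : CommutativeMonoid c′ ℓ′)
  (h : CommutativeMonoid.Carrier M → CommutativeMonoid.Carrier M′)
  (h-ε : CommutativeMonoid._≈_ M′ (h (CommutativeMonoid.ε M)) (CommutativeMonoid.ε M′))
  (h-∙ : ∀ x y → CommutativeMonoid._≈_ M′ (h (CommutativeMonoid._∙_ M x y))
                                           (CommutativeMonoid._∙_ M′ (h x) (h y))) where
  private
    module M = CommutativeMonoid M
    module M′ = CommutativeMonoid M′
    module S = FinSum M
    module S′ = FinSum M′

  h-∑ : ∀ D f → h (S.∑ D f) M′.≈ S′.∑ D (h ∘ f)
  h-∑ D f = go (f ∘ FinSet.element D)
    where
    go : ∀ {n} (t : Fin n → M.Carrier) → h (Sum.sum M t) M′.≈ Sum.sum M′ (h ∘ t)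
    go {zero}  t = h-ε
    go {suc n} t = M′.trans (h-∙ _ _) (M′.∙-congˡ (go (t ∘ suc)))

  h-when : ∀ {p} {P : Set p} (P? : Dec P) x → h (S.when P? x) M′.≈ S′.when P? (h x)
  h-when (yes _) x = M′.refl
  h-when (no _)  x = h-ε

  h-fibreSum : ∀ D E (α : Elem D → Elem E) f b →
               h (S.fibreSum D E α f b) M′.≈ S′.fibreSum D E α (h ∘ f) b
  h-fibreSum D E α f b =
    M′.trans (h-∑ D λ a → S.when (FinSet._≟_ E (α a) b) (f a)) (S′.∑-cong D λ a → h-when (FinSet._≟_ E (α a) b) (f a))

infix 4 _≡_[mod_]
record _≡_[mod_] (x y : ℤ) (m : ℕ) : Set where
  constructor congruent
  field
    m∣x-y : + m ∣ x ℤ.- y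

-- ℤ_m is presented as the integers with congruence modulo m as equality.
ℤ/_ : ℕ → CommutativeRing 0ℓ 0ℓ
ℤ/ m = record
  { Carrier = ℤ
  ; _≈_ = _≡_[mod m ]
  ; _+_ = ℤ._+_
  ; _*_ = ℤ._*_
  ; -_ = ℤ.-_
  ; 0# = ℤ.0ℤ
  ; 1# = ℤ.1ℤ
  ; isCommutativeRing = record
    { isRing = record
      { +-isAbelianGroup = record
        { isGroup = record
          { isMonoid = record
            { isSemigroup = record
              { isMagma = record
                { isEquivalence = record { refl = reflexive ≡.refl ; sym = sym ; trans = trans }
                ; ∙-cong = +-cong
                }
              ; assoc = λ x y z → reflexive (ℤ.+-assoc x y z)
              }
            ; identity = reflexive ∘ ℤ.+-identityˡ , reflexive ∘ ℤ.+-identityʳ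
            }
          ; inverse = reflexive ∘ ℤ.+-inverseˡ , reflexive ∘ ℤ.+-inverseʳ
          ; ⁻¹-cong = neg-cong
          }
        ; comm = λ x y → reflexive (ℤ.+-comm x y)
        }
      ; *-cong = *-cong
      ; *-assoc = λ x y z → reflexive (ℤ.*-assoc x y z)
      ; *-identity = reflexive ∘ ℤ.*-identityˡ , reflexive ∘ ℤ.*-identityʳ
      ; distrib = (λ x y z → reflexive (ℤ.*-distribˡ-+ x y z))
                , (λ x y z → reflexive (ℤ.*-distribʳ-+ x y z))
      }
    ; *-comm = λ x y → reflexive (ℤ.*-comm x y)
    }
  }
  where
  open +-*-Solver

  reflexive : ∀ {x y} → x ≡ y → x ≡ y [mod m ]
  reflexive {x} ≡.refl = congruent (divides ℤ.0ℤ (ℤ.+-inverseʳ x))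

  sym : ∀ {x y} → x ≡ y [mod m ] → y ≡ x [mod m ]
  sym {x} {y} (congruent d) = congruent (≡.subst (+ m ∣_)
    (solve 2 (λ x y → :- (x :- y) := y :- x) ≡.refl x y) (∣m⇒∣-m d))

  trans : ∀ {x y z} → x ≡ y [mod m ] → y ≡ z [mod m ] → x ≡ z [mod m ]
  trans {x} {y} {z} (congruent d) (congruent e) = congruent (≡.subst (+ m ∣_)
    (solve 3 (λ x y z → (x :- y) :+ (y :- z) := x :- z) ≡.refl x y z) (∣m∣n⇒∣m+n d e))

  +-cong : ∀ {x y u v} → x ≡ y [mod m ] → u ≡ v [mod m ] → x ℤ.+ u ≡ y ℤ.+ v [mod m ]
  +-cong {x} {y} {u} {v} (congruent d) (congruent e) = congruent (≡.subst (+ m ∣_)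
    (solve 4 (λ x y u v → (x :- y) :+ (u :- v) := (x :+ u) :- (y :+ v)) ≡.refl x y u v)
    (∣m∣n⇒∣m+n d e))

  *-cong : ∀ {x y u v} → x ≡ y [mod m ] → u ≡ v [mod m ] → x ℤ.* u ≡ y ℤ.* v [mod m ]
  *-cong {x} {y} {u} {v} (congruent d) (congruent e) = congruent (≡.subst (+ m ∣_)
    (solve 4 (λ x y u v → u :* (x :- y) :+ y :* (u :- v) := (x :* u) :- (y :* v)) ≡.refl x y u v)
    (∣m∣n⇒∣m+n (∣n⇒∣m*n u d) (∣n⇒∣m*n y e)))

  neg-cong : ∀ {x y} → x ≡ y [mod m ] → ℤ.- x ≡ ℤ.- y [mod m ]
  neg-cong {x} {y} (congruent d) = congruent (≡.subst (+ m ∣_)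
    (solve 2 (λ x y → :- (x :- y) := (:- x) :- (:- y)) ≡.refl x y) (∣m⇒∣-m d))

𝒵 : ℕ → Minion 0ℓ 0ℓ
𝒵 m = record
  { obj = λ D → record
    { Carrier = Σ[ f ∈ (Elem D → Carrier) ] ∑ D f ≈ 1#
    ; _≈_ = λ f g → ∀ a → proj₁ f a ≈ proj₁ g a
    ; isEquivalence = record
      { refl = λ _ → refl ; sym = λ e a → sym (e a) ; trans = λ d e a → trans (d a) (e a) }
    }
  ; map = λ D E α → record
    { to = λ (f , ∑f≈1) → fibreSum D E α f , trans (∑-fibreSum D E α f) ∑f≈1
    ; cong = λ {f} {g} → fibreSum-cong D E {α} {f = proj₁ f} {proj₁ g} (λ _ → ≡.refl)
    }
  ; map-cong = λ D E α≗β (f , _) → fibreSum-cong D E {f = f} α≗β λ _ → refl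
  ; map-id = λ D (f , _) → fibreSum-id D f
  ; map-∘ = λ D E F β α (f , _) → fibreSum-∘ D E F β α f
  }
  where
  open CommutativeRing (ℤ/ m)
  open FinSum +-commutativeMonoid

-- The construction 𝒱₂ over an arbitrary commutative ring R.
module V₂ (R : CommutativeRing 0ℓ 0ℓ) where
  open CommutativeRing R renaming (Carrier to A)

  -- R^N as the N-fold power of R: addition, multiplication (that is, ⊙) and
  -- equality are componentwise, and 1# is the vector (1,…,1).
  module Vec (N : ℕ) where
    open CommutativeRing (Pointwise.commutativeRing (Fin N) R) public
      using ()
      renaming (Carrier to Vector; _≈_ to _≋_; _+_ to _⊕_; _*_ to _⊙_; 0# to 𝟎; 1# to 𝟏;
                +-commutativeMonoid to ⊕-commutativeMonoid;
                isEquivalence to ≋-isEquivalence;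
                refl to ≋-refl; sym to ≋-sym; trans to ≋-trans)

    open FinSum ⊕-commutativeMonoid public

    infixr 7 _·_
    _·_ : A → Vector → Vector
    (r · u) k = r * u k

    𝔴 : Vector → A
    𝔴 = SemiringSum.sum semiring

    record Subspace : Set₁ where
      field
        member   : Pred Vector 0ℓ
        resp-≋   : ∀ {u v} → u ≋ v → u ∈ member → v ∈ member
        𝟎-closed : 𝟎 ∈ member
        ⊕-closed : ∀ {u v} → u ∈ member → v ∈ member → (u ⊕ v) ∈ member
        ·-closed : ∀ r {u} → u ∈ member → (r · u) ∈ member

    record Triple (D : FinSet) : Set₁ where
      field
        V    : Subspace
        𝐢    : Vector
        𝐯    : Elem D → Vector
        𝐢∈V  : 𝐢 ∈ Subspace.member V
        𝐯∈V  : ∀ a → 𝐯 a ∈ Subspace.member V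
        ax-i : 𝐢 ≋ 𝟏 × 𝔴 𝐢 ≈ 1#
        ax-s : ∑ D 𝐯 ≋ 𝐢
        ax-o : ∀ a b → a ≢ b → 𝔴 (𝐯 a ⊙ 𝐯 b) ≈ 0#
        ax-p : ∀ a → 𝔴 (𝐯 a ⊙ 𝐯 a) ≈ 𝔴 (𝐯 a)

    𝔴-cong : ∀ {u v} → u ≋ v → 𝔴 u ≈ 𝔴 v
    𝔴-cong = SemiringSum.sum-cong-≋ semiring

    𝔴-⊕ : ∀ u v → 𝔴 (u ⊕ v) ≈ 𝔴 u + 𝔴 v
    𝔴-⊕ = SemiringSum.∑-distrib-+ semiring

    𝔴-𝟎 : 𝔴 𝟎 ≈ 0#
    𝔴-𝟎 = SemiringSum.sum-replicate-zero semiring N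

    private
      module S = FinSum +-commutativeMonoid
      module 𝔴-sum = SumHom ⊕-commutativeMonoid +-commutativeMonoid 𝔴 𝔴-𝟎 𝔴-⊕
      module ⊙ˡ-sum (v : Vector) = SumHom ⊕-commutativeMonoid +-commutativeMonoid
        (λ u → 𝔴 (u ⊙ v))
        (trans (𝔴-cong λ k → zeroˡ (v k)) 𝔴-𝟎)
        (λ x y → trans (𝔴-cong λ k → distribʳ (v k) (x k) (y k)) (𝔴-⊕ _ _))
      module ⊙ʳ-sum (u : Vector) = SumHom ⊕-commutativeMonoid +-commutativeMonoid
        (λ v → 𝔴 (u ⊙ v))
        (trans (𝔴-cong λ k → zeroʳ (u k)) 𝔴-𝟎)
        (λ x y → trans (𝔴-cong λ k → distribˡ (u k) (x k) (y k)) (𝔴-⊕ _ _))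

    push : ∀ D E → (Elem D → Elem E) → Triple D → Triple E
    push D E α t = record
      { V = V
      ; 𝐢 = 𝐢
      ; 𝐯 = 𝐯′
      ; 𝐢∈V = 𝐢∈V
      ; 𝐯∈V = fibreSum-closed member 𝟎-closed ⊕-closed D E α 𝐯 𝐯∈V
      ; ax-i = ax-i
      ; ax-s = ≋-trans (∑-fibreSum D E α 𝐯) ax-s
      ; ax-o = λ b b′ b≢b′ → trans (expand b b′) (S.∑-ε D _ λ a →
          S.when-ε (α a E.≟ b) λ αa≡b → S.∑-ε D _ λ a′ →
            S.when-ε (α a′ E.≟ b′) λ αa′≡b′ → ax-o a a′ λ a≡a′ →
              b≢b′ (≡.trans (≡.sym αa≡b) (≡.trans (≡.cong α a≡a′) αa′≡b′)))
      ; ax-p = λ b → trans (expand b b) (trans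
          (S.∑-cong D λ a → S.when-cong (α a E.≟ b) λ αa≡b →
            trans (S.∑-single D _ a λ a′ a′≢a → S.when-ε (α a′ E.≟ b) λ _ →
                     ax-o a a′ (a′≢a ∘ ≡.sym))
                  (trans (S.when-yes (α a E.≟ b) αa≡b) (ax-p a)))
          (sym (𝔴-sum.h-fibreSum D E α 𝐯 b)))
      }
      where
      module E = FinSet E
      open Triple t
      open Subspace V
      𝐯′ : Elem E → Vector
      𝐯′ = fibreSum D E α 𝐯

      inner : Elem D → Elem E → A
      inner a b′ = S.fibreSum D E α (λ a′ → 𝔴 (𝐯 a ⊙ 𝐯 a′)) b′

      expand : ∀ b b′ → 𝔴 (𝐯′ b ⊙ 𝐯′ b′) ≈ S.∑ D λ a → S.when (α a E.≟ b) (inner a b′)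
      expand b b′ = trans (⊙ˡ-sum.h-fibreSum (𝐯′ b′) D E α 𝐯 b)
        (S.∑-cong D λ a → S.when-cong (α a E.≟ b) λ _ → ⊙ʳ-sum.h-fibreSum (𝐯 a) D E α 𝐯 b′)

  open Vec using (Triple; push)

  -- Equality of triples: the same ambient dimension N, the same set of
  -- vectors V, and equal 𝐢 and 𝐯.
  infix 4 _≃_
  data _≃_ {D : FinSet} : (s t : Σ ℕ λ N → Triple N D) → Set₁ where
    same : ∀ {N} {s t : Triple N D}
         → Vec.Subspace.member (Triple.V s) ≐ Vec.Subspace.member (Triple.V t)
         → Vec._≋_ N (Triple.𝐢 s) (Triple.𝐢 t)
         → (∀ a → Vec._≋_ N (Triple.𝐯 s a) (Triple.𝐯 t a))
         → (N , s) ≃ (N , t)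

  minion : Minion (lsuc 0ℓ) (lsuc 0ℓ)
  minion = record
    { obj = λ D → record
      { Carrier = Σ ℕ λ N → Triple N D
      ; _≈_ = _≃_
      ; isEquivalence = record
        { refl = λ {(N , s)} → same (id , id) (Vec.≋-refl N) (λ _ → Vec.≋-refl N)
        ; sym = λ { (same {N} (p , q) i v) → same (q , p) (Vec.≋-sym N i) (Vec.≋-sym N ∘ v) }
        ; trans = λ { (same {N} (p , q) i v) (same (p′ , q′) i′ v′) →
            same ((λ x → p′ (p x)) , (λ x → q (q′ x)))
                 (Vec.≋-trans N i i′) (λ a → Vec.≋-trans N (v a) (v′ a)) }
        }
      }
    ; map = λ D E α → record
      { to = λ (N , s) → N , push N D E α s
      ; cong = λ { (same {N} {s} {t} V≐ i v) →
          same V≐ i (Vec.fibreSum-cong N D E {α} {f = Triple.𝐯 s} {Triple.𝐯 t} (λ _ → ≡.refl) v) }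
      }
    ; map-cong = λ D E α≗β (N , s) → same (id , id) (Vec.≋-refl N)
        (Vec.fibreSum-cong N D E {f = Triple.𝐯 s} α≗β λ _ → Vec.≋-refl N)
    ; map-id = λ D (N , s) → same (id , id) (Vec.≋-refl N) (Vec.fibreSum-id N D (Triple.𝐯 s))
    ; map-∘ = λ D E F β α (N , s) → same (id , id) (Vec.≋-refl N)
        (Vec.fibreSum-∘ N D E F β α (Triple.𝐯 s))
    }

𝒱₂-ℤ : ℕ → Minion (lsuc 0ℓ) (lsuc 0ℓ)
𝒱₂-ℤ p = V₂.minion (ℤ/ p)

{-# OPTIONS --safe #-}

-- By naturality, a homomorphism ξ yields for each N with N ≡ 1 (mod p) a function
-- μ on the vectors u with ⟨u,u⟩ = 𝔴 u (the first entry of ξ at (u, 0, 1 - u)) that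
-- is additive on orthogonal pairs and has μ(1,…,1) = 1 in ℤ_{p²}.  If u is null
-- (⟨u,u⟩ = 𝔴 u = 0), then μ(n u) = n μ(u), hence p μ(u) = 0.
--
-- On a suitable space of vectors with five free entries the form is
-- x₁² + x₂² + x₃² - y₁² - y₂² and 𝔴 is x₁ + x₂ + x₃ - y₁ - y₂.  Let h = 1/2 and
--   b = (1,0,0|1,0)   c = (h,0,0|0,-h)   d = (0,h,0|h,0)   e = (0,0,0|0,1).
-- Both sides of (b + (t+1)c) + (e + (t+1)d) = (b + tc) + (e + c + (t+1)d) are
-- orthogonal sums, and d is null and orthogonal to e and e + c, so
-- μ(b + (t+1)c) - μ(b + tc) = μ(e + c) - μ(e) for all t.  Since b + pc = b, this
-- gives p μ(e) = p μ(e + c), which vanishes because e + c is null.  Writing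
-- x₁,…,y₂ for the unit vectors, x₁ + y₂ is null and y₂ = e, so also p μ(x₁) = 0.
-- Finally (1,…,1) is the orthogonal sum of x₁ and the null vectors x₂ + y₁ and
-- x₃ + y₂, so p = p μ(1,…,1) = 0 in ℤ_{p²}, which is absurd.

module Submission where

open import Defs
open import Algebra.Bundles using (CommutativeRing)
import Algebra.Properties.Group as GroupProperties
import Algebra.Properties.Semiring.Sum as SemiringSum
open import Data.Fin.Base using (Fin; zero; suc)
open import Data.Fin.Patterns using (0F; 1F; 2F; 3F; 4F)
open import Data.Integer.Base as ℤ using (ℤ; +_)
open import Data.Integer.Divisibility.Signed using (divides; _∣?_; ∣⇒∣ᵤ)
import Data.Integer.Properties as ℤ
open import Data.Integer.Solver using (module +-*-Solver)
open import Data.Nat.Base as ℕ using (ℕ; zero; suc; _<_; _^_)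
import Data.Nat.Divisibility as ℕ
import Data.Nat.DivMod as ℕ
import Data.Nat.Properties as ℕ
open import Data.Nat.Primality using (Prime; prime⇒irreducible)
open import Data.Product using (∃; _×_; _,_; proj₁; proj₂)
open import Data.Sum.Base using (inj₂)
open import Data.Unit.Base using (⊤)
open import Function.Base using (_∘_)
open import Function.Bundles using (Func)
open import Function.Construct.Identity using (↔-id)
open import Relation.Binary.PropositionalEquality as ≡ using (_≡_; _≢_)
import Relation.Binary.Reasoning.Setoid as SetoidReasoning
open import Relation.Nullary.Decidable using (Dec; yes; no; map′)
open import Relation.Nullary.Negation using (¬_; contradiction)

open +-*-Solver

Three : FinSet
Three = record { Elem = Fin 3 ; size = 3 ; enum = ↔-id (Fin 3) }

-- The form ⟨u,v⟩, idempotent vectors and null vectors.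

module Geometry (p N : ℕ) where

  open V₂ (ℤ/ p)
  open Vec N hiding (push)
  open CommutativeRing (ℤ/ p)

  infix 4 _⟂_
  ⟨_,_⟩ : Vector → Vector → ℤ
  ⟨ u , v ⟩ = 𝔴 (u ⊙ v)

  _⟂_ : Vector → Vector → Set
  u ⟂ v = ⟨ u , v ⟩ ≈ 0#

  Idempotent : Vector → Set
  Idempotent u = ⟨ u , u ⟩ ≈ 𝔴 u

  ⟂-sym : ∀ {u v} → u ⟂ v → v ⟂ u
  ⟂-sym {u} {v} u⟂v = trans (𝔴-cong λ k → *-comm (v k) (u k)) u⟂v

  rest : Vector → Vector → Vector
  rest u v k = 1# - u k - v k

  -- The vectors `u`, `v`, `rest u v` sum to `𝟏`, and pairing with `𝟏` is `𝔴`.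
  ⟨⟩-rest : ∀ x u v → ⟨ x , u ⟩ + (⟨ x , v ⟩ + ⟨ x , rest u v ⟩) ≈ 𝔴 x
  ⟨⟩-rest x u v = begin
    ⟨ x , u ⟩ + (⟨ x , v ⟩ + ⟨ x , rest u v ⟩)
      ≈⟨ +-congˡ {⟨ x , u ⟩} (𝔴-⊕ (x ⊙ v) (x ⊙ rest u v)) ⟨
    ⟨ x , u ⟩ + 𝔴 ((x ⊙ v) ⊕ (x ⊙ rest u v))
      ≈⟨ 𝔴-⊕ (x ⊙ u) _ ⟨
    𝔴 ((x ⊙ u) ⊕ ((x ⊙ v) ⊕ (x ⊙ rest u v)))
      ≈⟨ 𝔴-cong (λ k → reflexive (solve 3
           (λ x u v → x :* u :+ (x :* v :+ x :* (con 1# :- u :- v)) := x) ≡.refl (x k) (u k) (v k))) ⟩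
    𝔴 x ∎
    where open SetoidReasoning setoid

  -- In `⟨⟩-rest` at `x = u` the first summand already equals `𝔴 u` and the second vanishes, so
  -- cancelling `𝔴 u` kills the third.
  ⟂-rest : ∀ {u v} → Idempotent u → u ⟂ v → u ⟂ rest u v
  ⟂-rest {u} {v} uu u⟂v = GroupProperties.∙-cancelˡ +-group (𝔴 u) _ _ (begin
    𝔴 u + ⟨ u , rest u v ⟩                       ≈⟨ +-cong (sym uu) (sym (trans (+-congʳ u⟂v) (+-identityˡ _))) ⟩
    ⟨ u , u ⟩ + (⟨ u , v ⟩ + ⟨ u , rest u v ⟩)   ≈⟨ ⟨⟩-rest u u v ⟩
    𝔴 u                                          ≈⟨ +-identityʳ _ ⟨
    𝔴 u + 0#                                     ∎)
    where open SetoidReasoning setoid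

  𝟎-idempotent : Idempotent 𝟎
  𝟎-idempotent = refl

  ⟂-𝟎 : ∀ u → u ⟂ 𝟎
  ⟂-𝟎 u = trans (𝔴-cong λ k → zeroʳ (u k)) 𝔴-𝟎

  idempotent-⊕ : ∀ {u v} → Idempotent u → Idempotent v → u ⟂ v → Idempotent (u ⊕ v)
  idempotent-⊕ {u} {v} uu vv u⟂v = begin
    ⟨ u ⊕ v , u ⊕ v ⟩
      ≈⟨ 𝔴-cong (λ k → reflexive (solve 2 (λ u v →
           (u :+ v) :* (u :+ v) := (u :* u :+ v :* v) :+ (u :* v :+ u :* v)) ≡.refl (u k) (v k))) ⟩
    𝔴 (((u ⊙ u) ⊕ (v ⊙ v)) ⊕ ((u ⊙ v) ⊕ (u ⊙ v)))
      ≈⟨ 𝔴-⊕ ((u ⊙ u) ⊕ (v ⊙ v)) ((u ⊙ v) ⊕ (u ⊙ v)) ⟩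
    𝔴 ((u ⊙ u) ⊕ (v ⊙ v)) + 𝔴 ((u ⊙ v) ⊕ (u ⊙ v))
      ≈⟨ +-cong (𝔴-⊕ (u ⊙ u) (v ⊙ v)) (trans (𝔴-⊕ (u ⊙ v) (u ⊙ v)) (+-cong u⟂v u⟂v)) ⟩
    (⟨ u , u ⟩ + ⟨ v , v ⟩) + 0#
      ≈⟨ trans (+-identityʳ _) (+-cong uu vv) ⟩
    𝔴 u + 𝔴 v
      ≈⟨ 𝔴-⊕ u v ⟨
    𝔴 (u ⊕ v) ∎
    where open SetoidReasoning setoid

  ⟂-· : ∀ {u v} r → u ⟂ v → u ⟂ (r · v)
  ⟂-· {u} {v} r u⟂v = begin
    ⟨ u , r · v ⟩   ≈⟨ 𝔴-cong (λ k → reflexive (solve 3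
                         (λ r u v → u :* (r :* v) := r :* (u :* v)) ≡.refl r (u k) (v k))) ⟩
    𝔴 (r · (u ⊙ v)) ≈⟨ SemiringSum.*-distribˡ-sum semiring r (u ⊙ v) ⟨
    r * ⟨ u , v ⟩   ≈⟨ *-congˡ {r} u⟂v ⟩
    r * 0#          ≈⟨ zeroʳ r ⟩
    0# ∎
    where open SetoidReasoning setoid

  Null : Vector → Set
  Null u = u ⟂ u × 𝔴 u ≈ 0#

  null⇒idempotent : ∀ {u} → Null u → Idempotent u
  null⇒idempotent (uu , wu) = trans uu (sym wu)

  null-· : ∀ {u} r → Null u → Null (r · u)
  null-· {u} r (uu , wu) =
    ⟂-· {r · u} {u} r (⟂-sym {u} {r · u} (⟂-· {u} {u} r uu)) ,
    (begin
      𝔴 (r · u) ≈⟨ SemiringSum.*-distribˡ-sum semiring r u ⟨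
      r * 𝔴 u   ≈⟨ *-congˡ {r} wu ⟩
      r * 0#    ≈⟨ zeroʳ r ⟩
      0#        ∎)
    where open SetoidReasoning setoid

  -- What is kept of a homomorphism into `𝒵 M`. The function is total, but the laws constrain it
  -- only on idempotent vectors, those allowed in a triple by axiom (p).
  record OrthogonalMeasure (M : ℕ) : Set where
    open CommutativeRing (ℤ/ M) using () renaming (_≈_ to _≈ᴹ_)
    field
      μ      : Vector → ℤ
      μ-cong : ∀ {u v} → Idempotent u → u ≋ v → μ u ≈ᴹ μ v
      μ-⊕    : ∀ {u v} → Idempotent u → Idempotent v → u ⟂ v → μ (u ⊕ v) ≈ᴹ μ u + μ v
      μ-𝟏    : μ 𝟏 ≈ᴹ 1#

-- Consequences of orthogonal additivity.

module Measures {p N M : ℕ} (measure : Geometry.OrthogonalMeasure p N M) where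

  open V₂ (ℤ/ p)
  open Vec N hiding (push)
  open CommutativeRing (ℤ/ p)
  open Geometry p N
  open OrthogonalMeasure measure
  private module M = CommutativeRing (ℤ/ M)
  open SetoidReasoning M.setoid

  μ-𝟎 : μ 𝟎 M.≈ 0#
  μ-𝟎 = GroupProperties.identityʳ-unique M.+-group (μ 𝟎) _
    (M.trans (M.sym (μ-⊕ {𝟎} {𝟎} 𝟎-idempotent 𝟎-idempotent (⟂-𝟎 𝟎)))
             (μ-cong {𝟎 ⊕ 𝟎} {𝟎} 𝟎-idempotent λ _ → refl))

  -- A null vector is orthogonal to all its own multiples, so additivity peels off one copy of `u`
  -- at a time.
  μ-· : ∀ n {u} → Null u → μ ((+ n) · u) M.≈ + n * μ u
  μ-· zero {u} nu =
    M.trans (μ-cong {(+ 0) · u} {𝟎} (null⇒idempotent {(+ 0) · u} (null-· {u} (+ 0) nu)) λ k → zeroˡ (u k)) μ-𝟎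
  μ-· (suc n) {u} nu = begin
    μ ((+ suc n) · u)
      ≈⟨ μ-cong {(+ suc n) · u} {u ⊕ (+ n) · u}
           (null⇒idempotent {(+ suc n) · u} (null-· {u} (+ suc n) nu)) (λ k → reflexive (eq (u k))) ⟩
    μ (u ⊕ (+ n) · u)
      ≈⟨ μ-⊕ {u} {(+ n) · u} (null⇒idempotent {u} nu) (null⇒idempotent {(+ n) · u} (null-· {u} (+ n) nu))
           (⟂-· {u} {u} (+ n) (proj₁ nu)) ⟩
    μ u + μ ((+ n) · u)
      ≈⟨ M.+-congˡ {μ u} (μ-· n {u} nu) ⟩
    μ u + + n * μ u
      ≡⟨ eq (μ u) ⟨
    + suc n * μ u  ∎
    where
    eq : ∀ x → + suc n * x ≡ x + + n * x
    eq x = solve 2 (λ n x → (con 1# :+ n) :* x := x :+ n :* x) ≡.refl (+ n) x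

  p·≋𝟎 : ∀ u → (+ p) · u ≋ 𝟎
  p·≋𝟎 u k = congruent (divides (u k)
    (solve 2 (λ p x → p :* x :- con 0# := x :* p) ≡.refl (+ p) (u k)))

  p*μ-null : ∀ {u} → Null u → + p * μ u M.≈ 0#
  p*μ-null {u} nu = M.trans (M.sym (μ-· p {u} nu))
    (M.trans (μ-cong {(+ p) · u} {𝟎} (null⇒idempotent {(+ p) · u} (null-· {u} (+ p) nu)) (p·≋𝟎 u)) μ-𝟎)

  -- The orthogonality hypotheses let one vector be decomposed in two ways. This makes the increment
  -- of `μ` along `b ⊕ t · c` independent of `t`, while that sequence has period `p`.
  p*μ-shift : ∀ {b c d e} → (∀ t → Idempotent (b ⊕ (+ t) · c)) → Idempotent e →
              Null d → Null (e ⊕ c) → e ⟂ d → (e ⊕ c) ⟂ d →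
              (∀ t → (b ⊕ (+ t) · c) ⟂ (e ⊕ (+ t) · d)) →
              (∀ t → (b ⊕ (+ t) · c) ⟂ ((e ⊕ c) ⊕ (+ suc t) · d)) →
              + p * μ e M.≈ 0#
  p*μ-shift {b} {c} {d} {e} vv ee nd nf e⟂d f⟂d v⟂ v⟂′ = begin
    + p * μ e
      -- After `p` steps `walk` is back at `v 0`, so the measures of the two end points cancel.
      ≈⟨ GroupProperties.∙-cancelˡ M.+-group (μ (v 0)) _ _
           (M.trans (M.+-congʳ (M.sym (μ-cong {v p} {v 0} (vv p) period))) (walk p)) ⟩
    + p * μ f
      ≈⟨ p*μ-null {f} nf ⟩
    0# ∎
    where
    v : ℕ → Vector
    v t = b ⊕ (+ t) · c

    f : Vector
    f = e ⊕ c

    period : v p ≋ v 0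
    period k = congruent (divides (c k) (solve 3 (λ p b c →
      (b :+ p :* c) :- (b :+ con 0# :* c) := c :* p) ≡.refl (+ p) (b k) (c k)))

    d-idempotent : ∀ t → Idempotent ((+ t) · d)
    d-idempotent t = null⇒idempotent {(+ t) · d} (null-· {d} (+ t) nd)

    μ-with-d : ∀ {x y} t → Idempotent x → Idempotent y → y ⟂ d → x ⟂ (y ⊕ (+ t) · d) →
               μ (x ⊕ (y ⊕ (+ t) · d)) M.≈ μ x + (μ y + μ ((+ t) · d))
    μ-with-d {x} {y} t xx yy y⟂d x⟂ = M.trans
      (μ-⊕ {x} {y ⊕ (+ t) · d} xx
        (idempotent-⊕ {y} {(+ t) · d} yy (d-idempotent t) (⟂-· {y} {d} (+ t) y⟂d)) x⟂)
      (M.+-congˡ {μ x} (μ-⊕ {y} {(+ t) · d} yy (d-idempotent t) (⟂-· {y} {d} (+ t) y⟂d)))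

    step : ∀ t → μ (v (suc t)) + μ e M.≈ μ (v t) + μ f
    -- Both decompositions contain the summand `s · d`; its measure is added to both sides and
    -- cancelled at the end.
    step t = GroupProperties.∙-cancelʳ M.+-group (μ ((+ s) · d)) _ _ (begin
      (μ (v s) + μ e) + μ ((+ s) · d)
        ≡⟨ ℤ.+-assoc (μ (v s)) (μ e) _ ⟩
      μ (v s) + (μ e + μ ((+ s) · d))
        ≈⟨ μ-with-d {v s} {e} s (vv s) ee e⟂d (v⟂ s) ⟨
      μ (v s ⊕ (e ⊕ (+ s) · d))
        ≈⟨ μ-cong {v s ⊕ (e ⊕ (+ s) · d)} {v t ⊕ (f ⊕ (+ s) · d)}
             (idempotent-⊕ {v s} {e ⊕ (+ s) · d} (vv s)
               (idempotent-⊕ {e} {(+ s) · d} ee (d-idempotent s) (⟂-· {e} {d} (+ s) e⟂d)) (v⟂ s))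
             (λ k → reflexive (solve 5 (λ t b c d e →
               (b :+ (con 1# :+ t) :* c) :+ (e :+ d) := (b :+ t :* c) :+ ((e :+ c) :+ d))
               ≡.refl (+ t) (b k) (c k) (+ s * d k) (e k))) ⟩
      μ (v t ⊕ (f ⊕ (+ s) · d))
        ≈⟨ μ-with-d {v t} {f} s (vv t) (null⇒idempotent {f} nf) f⟂d (v⟂′ t) ⟩
      μ (v t) + (μ f + μ ((+ s) · d))
        ≡⟨ ℤ.+-assoc (μ (v t)) (μ f) _ ⟨
      (μ (v t) + μ f) + μ ((+ s) · d) ∎)
      where
      s : ℕ
      s = suc t

    walk : ∀ n → μ (v n) + + n * μ e M.≈ μ (v 0) + + n * μ f
    walk zero = M.reflexive ≡.refl
    walk (suc n) = begin
      μ (v (suc n)) + + suc n * μ e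
        ≡⟨ solve 3 (λ n x y → x :+ (con 1# :+ n) :* y := (x :+ y) :+ n :* y)
             ≡.refl (+ n) (μ (v (suc n))) (μ e) ⟩
      (μ (v (suc n)) + μ e) + + n * μ e
        ≈⟨ M.+-congʳ {+ n * μ e} (step n) ⟩
      (μ (v n) + μ f) + + n * μ e
        ≡⟨ solve 3 (λ x y z → (x :+ y) :+ z := (x :+ z) :+ y) ≡.refl (μ (v n)) (μ f) (+ n * μ e) ⟩
      (μ (v n) + + n * μ e) + μ f
        ≈⟨ M.+-congʳ {μ f} (walk n) ⟩
      (μ (v 0) + + n * μ f) + μ f
        ≡⟨ solve 3 (λ n x y → (x :+ n :* y) :+ y := x :+ (con 1# :+ n) :* y)
             ≡.refl (+ n) (μ (v 0)) (μ f) ⟩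
      μ (v 0) + + suc n * μ f ∎

-- The space with five free entries and the computations in it.

five : ∀ {a} {A : Set a} → A → A → A → A → A → Fin 5 → A
five x₁ x₂ x₃ y₁ y₂ 0F = x₁
five x₁ x₂ x₃ y₁ y₂ 1F = x₂
five x₁ x₂ x₃ y₁ y₂ 2F = x₃
five x₁ x₂ x₃ y₁ y₂ 3F = y₁
five x₁ x₂ x₃ y₁ y₂ 4F = y₂

pairs : ∀ q → Fin (q ℕ.* 2) → Fin 5
pairs (suc q) zero          = 3F
pairs (suc q) (suc zero)    = 4F
pairs (suc q) (suc (suc i)) = pairs q i

-- Vectors of the shape x ∘ block q have three free coordinates and two further
-- values, each repeated q times; since q ≡ -1 modulo suc q, the form on them is
-- x₁² + x₂² + x₃² - y₁² - y₂².
block : ∀ q → Fin (3 ℕ.+ q ℕ.* 2) → Fin 5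
block q zero                = 0F
block q (suc zero)          = 1F
block q (suc (suc zero))    = 2F
block q (suc (suc (suc i))) = pairs q i

module Blocks (q : ℕ) where

  p : ℕ
  p = suc q

  N : ℕ
  N = 3 ℕ.+ q ℕ.* 2

  open V₂ (ℤ/ p)
  open Vec N hiding (push)
  open CommutativeRing (ℤ/ p)
  open Geometry p N

  weight : (Fin 5 → ℤ) → ℤ
  weight f = (f 0F + f 1F + f 2F) - (f 3F + f 4F)

  𝔴-pairs : ∀ n (f : Fin 5 → ℤ) → Vec.𝔴 (n ℕ.* 2) (f ∘ pairs n) ≡ + n * (f 3F + f 4F)
  𝔴-pairs zero    f = ≡.refl
  𝔴-pairs (suc n) f = ≡.trans (≡.cong (λ s → f 3F + (f 4F + s)) (𝔴-pairs n f))
    (solve 3 (λ n x y → x :+ (y :+ n :* (x :+ y)) := (con 1# :+ n) :* (x :+ y))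
      ≡.refl (+ n) (f 3F) (f 4F))

  𝔴-block : ∀ f → 𝔴 (f ∘ block q) ≈ weight f
  𝔴-block f = trans
    (reflexive (≡.cong (λ s → f 0F + (f 1F + (f 2F + s))) (𝔴-pairs q f)))
    -- The two sides differ by `(q + 1)(y₁ + y₂)`, a multiple of `p`.
    (congruent (divides (f 3F + f 4F) (solve 6 (λ q x₁ x₂ x₃ y₁ y₂ →
      (x₁ :+ (x₂ :+ (x₃ :+ q :* (y₁ :+ y₂)))) :- ((x₁ :+ x₂ :+ x₃) :- (y₁ :+ y₂))
        := (y₁ :+ y₂) :* (con 1# :+ q)) ≡.refl (+ q) (f 0F) (f 1F) (f 2F) (f 3F) (f 4F))))

  block-⟂ : ∀ x y → weight (λ i → x i * y i) ≡ 0# → (x ∘ block q) ⟂ (y ∘ block q)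
  block-⟂ x y eq = trans (𝔴-block λ i → x i * y i) (reflexive eq)

  block-idempotent : ∀ x → weight (λ i → x i * x i) ≡ weight x → Idempotent (x ∘ block q)
  block-idempotent x eq =
    trans (𝔴-block λ i → x i * x i) (trans (reflexive eq) (sym (𝔴-block x)))

  block-null : ∀ x → weight (λ i → x i * x i) ≈ 0# → weight x ≈ 0# → Null (x ∘ block q)
  block-null x xx wx = trans (𝔴-block λ i → x i * x i) xx , trans (𝔴-block x) wx

  -- Three positive and two negative entries give 3 - 2 = 1, as axiom (i) requires of the ambient
  -- dimension.
  𝔴-𝟏 : 𝔴 𝟏 ≈ 1#
  𝔴-𝟏 = 𝔴-block λ _ → 1#

  -- An integer representing 1/2 modulo `p`. Only `f-null` relies on the equation; the other claims
  -- about weights are polynomial identities in `h`.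
  module _ (h : ℤ) (2h≡1+p : h + h ≡ 1# + + p) where

    b c d e f x n₁ n₂ : Fin 5 → ℤ
    b = five 1# 0# 0# 1# 0#
    c = five h 0# 0# 0# (- h)
    d = five 0# h 0# h 0#
    e = five 0# 0# 0# 0# 1#
    f i = e i + c i
    x = five 1# 0# 0# 0# 0#
    n₁ = five 0# 1# 0# 1# 0#
    n₂ = five 0# 0# 1# 0# 1#

    -- Symbolic copies of the vectors, from which the ring solver reads off the weight identities.
    module _ {n : ℕ} where

      weightᴾ : (Fin 5 → Polynomial n) → Polynomial n
      weightᴾ f = (f 0F :+ f 1F :+ f 2F) :- (f 3F :+ f 4F)

      bᴾ eᴾ : Fin 5 → Polynomial n
      bᴾ = five (con 1#) (con 0#) (con 0#) (con 1#) (con 0#)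
      eᴾ = five (con 0#) (con 0#) (con 0#) (con 0#) (con 1#)

      cᴾ dᴾ fᴾ : Polynomial n → Fin 5 → Polynomial n
      cᴾ h = five h (con 0#) (con 0#) (con 0#) (:- h)
      dᴾ h = five (con 0#) h (con 0#) h (con 0#)
      fᴾ h i = eᴾ i :+ cᴾ h i

      vᴾ : Polynomial n → Polynomial n → Fin 5 → Polynomial n
      vᴾ h t i = bᴾ i :+ t :* cᴾ h i

    v : ℤ → Fin 5 → ℤ
    v t i = b i + t * c i

    v-idempotent : ∀ t → Idempotent (v t ∘ block q)
    v-idempotent t = block-idempotent (v t) (solve 2 (λ h t →
      weightᴾ (λ i → vᴾ h t i :* vᴾ h t i) := weightᴾ (vᴾ h t)) ≡.refl h t)

    v⟂ : ∀ t → (v t ∘ block q) ⟂ ((λ i → e i + t * d i) ∘ block q)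
    v⟂ t = block-⟂ (v t) (λ i → e i + t * d i) (solve 2 (λ h t →
      weightᴾ (λ i → vᴾ h t i :* (eᴾ i :+ t :* dᴾ h i)) := con 0#) ≡.refl h t)

    v⟂′ : ∀ t → (v t ∘ block q) ⟂ ((λ i → f i + (1# + t) * d i) ∘ block q)
    v⟂′ t = block-⟂ (v t) (λ i → f i + (1# + t) * d i) (solve 2 (λ h t →
      weightᴾ (λ i → vᴾ h t i :* (fᴾ h i :+ (con 1# :+ t) :* dᴾ h i)) := con 0#) ≡.refl h t)

    e⟂d : (e ∘ block q) ⟂ (d ∘ block q)
    e⟂d = block-⟂ e d (solve 1 (λ h → weightᴾ (λ i → eᴾ i :* dᴾ h i) := con 0#) ≡.refl h)

    f⟂d : (f ∘ block q) ⟂ (d ∘ block q)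
    f⟂d = block-⟂ f d (solve 1 (λ h → weightᴾ (λ i → fᴾ h i :* dᴾ h i) := con 0#) ≡.refl h)

    d-null : Null (d ∘ block q)
    d-null = block-null d
      (reflexive (solve 1 (λ h → weightᴾ (λ i → dᴾ h i :* dᴾ h i) := con 0#) ≡.refl h))
      (reflexive (solve 1 (λ h → weightᴾ (dᴾ h) := con 0#) ≡.refl h))

    f-null : Null (f ∘ block q)
    f-null = block-null f
      (trans (reflexive (solve 1 (λ h →
        weightᴾ (λ i → fᴾ h i :* fᴾ h i) := (h :+ h) :- con 1#) ≡.refl h)) 2h-1≈0)
      (trans (reflexive (solve 1 (λ h → weightᴾ (fᴾ h) := (h :+ h) :- con 1#) ≡.refl h)) 2h-1≈0)
      where
      2h-1≈0 : (h + h) - 1# ≈ 0#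
      2h-1≈0 = congruent (divides 1# (≡.trans
        (≡.cong (λ s → (s - 1#) - 0#) 2h≡1+p)
        (solve 1 (λ p → ((con 1# :+ p) :- con 1#) :- con 0# := con 1# :* p) ≡.refl (+ p))))

    p≈0 : ∀ {M} → OrthogonalMeasure M → + p ≡ 0# [mod M ]
    p≈0 {M} measure = begin
      + p
        ≡⟨ ℤ.*-identityʳ (+ p) ⟨
      + p * 1#
        ≈⟨ M.*-congˡ {+ p} (M.trans (M.sym μ-𝟏)
             (μ-cong {𝟏} {X ⊕ (N₁ ⊕ N₂)} refl (reflexive ∘ 𝟏-split ∘ block q))) ⟩
      + p * μ (X ⊕ (N₁ ⊕ N₂))
        ≈⟨ M.*-congˡ {+ p} (M.trans
             (μ-⊕ {X} {N₁ ⊕ N₂} X-idempotent (idempotent-⊕ {N₁} {N₂} N₁-idem N₂-idem N₁⟂N₂) X⟂)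
             (M.+-congˡ {μ X} (μ-⊕ {N₁} {N₂} N₁-idem N₂-idem N₁⟂N₂))) ⟩
      + p * (μ X + (μ N₁ + μ N₂))
        ≡⟨ solve 4 (λ p x y z → p :* (x :+ (y :+ z)) := p :* x :+ (p :* y :+ p :* z))
             ≡.refl (+ p) (μ X) (μ N₁) (μ N₂) ⟩
      + p * μ X + (+ p * μ N₁ + + p * μ N₂)
        ≈⟨ M.+-cong pμX≈0 (M.+-cong (p*μ-null {N₁} N₁-null) (p*μ-null {N₂} N₂-null)) ⟩
      0# ∎
      where
      module M = CommutativeRing (ℤ/ M)
      open SetoidReasoning M.setoid
      open OrthogonalMeasure measure
      open Measures measure

      X E N₁ N₂ : Vector
      X = x ∘ block q
      E = e ∘ block q
      N₁ = n₁ ∘ block q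
      N₂ = n₂ ∘ block q

      X-idempotent : Idempotent X
      X-idempotent = block-idempotent x ≡.refl

      E-idempotent : Idempotent E
      E-idempotent = block-idempotent e ≡.refl

      N₁-null : Null N₁
      N₁-null = block-null n₁ refl refl

      N₂-null : Null N₂
      N₂-null = block-null n₂ refl refl

      N₁-idem : Idempotent N₁
      N₁-idem = null⇒idempotent {N₁} N₁-null

      N₂-idem : Idempotent N₂
      N₂-idem = null⇒idempotent {N₂} N₂-null

      N₁⟂N₂ : N₁ ⟂ N₂
      N₁⟂N₂ = block-⟂ n₁ n₂ ≡.refl

      X⟂ : X ⟂ (N₁ ⊕ N₂)
      X⟂ = block-⟂ x (λ i → n₁ i + n₂ i) ≡.refl

      𝟏-split : ∀ i → 1# ≡ x i + (n₁ i + n₂ i)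
      𝟏-split 0F = ≡.refl
      𝟏-split 1F = ≡.refl
      𝟏-split 2F = ≡.refl
      𝟏-split 3F = ≡.refl
      𝟏-split 4F = ≡.refl

      pμE≈0 : + p * μ E M.≈ 0#
      pμE≈0 = p*μ-shift {b ∘ block q} {c ∘ block q} {d ∘ block q} {E}
        (v-idempotent ∘ +_) E-idempotent d-null f-null e⟂d f⟂d (v⟂ ∘ +_) (v⟂′ ∘ +_)

      pμX≈0 : + p * μ X M.≈ 0#
      pμX≈0 = begin
        + p * μ X               ≈⟨ M.trans (M.+-congˡ {+ p * μ X} pμE≈0) (M.+-identityʳ (+ p * μ X)) ⟨
        + p * μ X + + p * μ E   ≡⟨ ℤ.*-distribˡ-+ (+ p) (μ X) (μ E) ⟨
        + p * (μ X + μ E)       ≈⟨ M.*-congˡ {+ p} (μ-⊕ {X} {E} X-idempotent E-idempotent (block-⟂ x e ≡.refl)) ⟨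
        + p * μ (X ⊕ E)         ≈⟨ p*μ-null {X ⊕ E} (block-null (λ i → x i + e i) refl refl) ⟩
        0#                      ∎

-- From a homomorphism to an orthogonal measure.

module FromHom {p M : ℕ} (Ξ : MinionHom (𝒱₂-ℤ p) (𝒵 M)) {N : ℕ} where

  open V₂ (ℤ/ p)
  open Vec N hiding (push)
  open CommutativeRing (ℤ/ p)
  open Geometry p N
  private
    module M = CommutativeRing (ℤ/ M)
    module Ξ = MinionHom Ξ

  everything : Subspace
  everything = record
    { member = λ _ → ⊤ ; resp-≋ = λ _ _ → _ ; 𝟎-closed = _
    ; ⊕-closed = λ _ _ → _ ; ·-closed = λ _ _ → _ }

  family : Vector → Vector → Fin 3 → Vector
  family u v 0F = u
  family u v 1F = v
  family u v 2F = rest u v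

  triple : 𝔴 𝟏 ≈ 1# → ∀ {u v} → Idempotent u → Idempotent v → u ⟂ v → Triple Three
  triple 𝔴𝟏 {u} {v} uu vv u⟂v = record
    { V = everything
    ; 𝐢 = 𝟏
    ; 𝐯 = family u v
    ; 𝐢∈V = _
    ; 𝐯∈V = λ _ → _
    ; ax-i = ≋-refl , 𝔴𝟏
    ; ax-s = λ k → reflexive (solve 2 (λ u v → u :+ (v :+ ((con 1# :- u :- v) :+ con 0#)) := con 1#)
                                ≡.refl (u k) (v k))
    ; ax-o = orth
    ; ax-p = idem
    }
    where
    r = rest u v

    u⟂r : u ⟂ r
    u⟂r = ⟂-rest uu u⟂v

    v⟂r : v ⟂ r
    -- `rest` is symmetric in its arguments, so `⟂-rest` applies with `u` and `v` exchanged.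
    v⟂r = trans (𝔴-cong λ k → reflexive (solve 2
      (λ u v → v :* (con 1# :- u :- v) := v :* (con 1# :- v :- u)) ≡.refl (u k) (v k)))
      (⟂-rest vv (⟂-sym {u} {v} u⟂v))

    orth : ∀ a b → a ≢ b → family u v a ⟂ family u v b
    orth 0F 0F a≢b = contradiction ≡.refl a≢b
    orth 0F 1F _   = u⟂v
    orth 0F 2F _   = u⟂r
    orth 1F 0F _   = ⟂-sym {u} {v} u⟂v
    orth 1F 1F a≢b = contradiction ≡.refl a≢b
    orth 1F 2F _   = v⟂r
    orth 2F 0F _   = ⟂-sym {u} {r} u⟂r
    orth 2F 1F _   = ⟂-sym {v} {r} v⟂r
    orth 2F 2F a≢b = contradiction ≡.refl a≢b

    idem : ∀ a → Idempotent (family u v a)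
    idem 0F = uu
    idem 1F = vv
    idem 2F = begin
      -- In `⟨⟩-rest` at `x = r` the products with `u` and `v` vanish.
      ⟨ r , r ⟩                             ≈⟨ trans (+-identityˡ _) (+-identityˡ _) ⟨
      0# + (0# + ⟨ r , r ⟩)                 ≈⟨ +-cong (⟂-sym {u} {r} u⟂r) (+-congʳ (⟂-sym {v} {r} v⟂r)) ⟨
      ⟨ r , u ⟩ + (⟨ r , v ⟩ + ⟨ r , r ⟩)   ≈⟨ ⟨⟩-rest r u v ⟩
      𝔴 r                                   ∎
      where open SetoidReasoning setoid

  module _ (𝔴𝟏 : 𝔴 𝟏 ≈ 1#) where

    ξ : Triple Three → Fin 3 → ℤ
    ξ t = proj₁ (Func.to (Ξ.ξ Three) (N , t))

    opaque
      -- The proof of idempotency is an argument because the triple contains it; by `μ′-cong` the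
      -- value does not depend on that proof.
      μ′ : ∀ u → Idempotent u → ℤ
      μ′ u uu = ξ (triple 𝔴𝟏 {u} {𝟎} uu 𝟎-idempotent (⟂-𝟎 u)) 0F

      -- Naturality at `α`: once the pushed triple is recognised as the one defining `μ′ u`, its
      -- first entry is a fibre sum of the entries of `ξ t`.
      μ′-push : ∀ (t : Triple Three) (α : Fin 3 → Fin 3) {u} (uu : Idempotent u) →
               (∀ x → Vec.Subspace.member (Triple.V t) x) →
               (∀ a → Triple.𝐯 (Vec.push N Three Three α t) a ≋ family u 𝟎 a) →
               FinSum.fibreSum M.+-commutativeMonoid Three Three α (ξ t) 0F M.≈ μ′ u uu
      μ′-push t α uu full eq = M.trans
        (M.sym (Ξ.natural Three Three α (N , t) 0F))
        (Func.cong (Ξ.ξ Three) (same (_ , λ {x} _ → full x) (proj₁ (Triple.ax-i t)) eq) 0F)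

      μ′-cong : ∀ {u v} (uu : Idempotent u) (vv : Idempotent v) → u ≋ v → μ′ u uu M.≈ μ′ v vv
      μ′-cong {u} {v} uu vv u≋v = Func.cong (Ξ.ξ Three) (same (_ , _) ≋-refl λ
        { 0F → u≋v
        ; 1F → ≋-refl
        ; 2F → λ k → +-congʳ (+-congˡ {1#} (-‿cong (u≋v k)))
        }) 0F

    module _ {u v : Vector} (uu : Idempotent u) (vv : Idempotent v) (u⟂v : u ⟂ v) where
      private
        t : Triple Three
        t = triple 𝔴𝟏 {u} {v} uu vv u⟂v

        -- None of these maps hits `1F`, so the middle vector of each pushed family is the empty sum
        -- `𝟎`; the first one is `u ⊕ v`, `u` and `v` respectively.
        fuse onlyˡ onlyʳ : Fin 3 → Fin 3
        fuse  = λ { 0F → 0F ; 1F → 0F ; 2F → 2F }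
        onlyˡ = λ { 0F → 0F ; 1F → 2F ; 2F → 2F }
        onlyʳ = λ { 0F → 2F ; 1F → 0F ; 2F → 2F }

        push-fuse : ∀ a → fibreSum Three Three fuse (family u v) a ≋ family (u ⊕ v) 𝟎 a
        push-fuse 0F k = reflexive (solve 2 (λ u v →
          u :+ (v :+ (con 0# :+ con 0#)) := u :+ v) ≡.refl (u k) (v k))
        push-fuse 1F k = refl
        push-fuse 2F k = reflexive (solve 2 (λ u v →
          con 0# :+ (con 0# :+ (con 1# :- u :- v :+ con 0#)) := con 1# :- (u :+ v) :- con 0#)
          ≡.refl (u k) (v k))

        push-onlyˡ : ∀ a → fibreSum Three Three onlyˡ (family u v) a ≋ family u 𝟎 a
        push-onlyˡ 0F k = reflexive (solve 1 (λ u → u :+ con 0# := u) ≡.refl (u k))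
        push-onlyˡ 1F k = refl
        push-onlyˡ 2F k = reflexive (solve 2 (λ u v →
          con 0# :+ (v :+ ((con 1# :- u :- v) :+ con 0#)) := con 1# :- u :- con 0#)
          ≡.refl (u k) (v k))

        push-onlyʳ : ∀ a → fibreSum Three Three onlyʳ (family u v) a ≋ family v 𝟎 a
        push-onlyʳ 0F k = reflexive (solve 1 (λ v → con 0# :+ (v :+ con 0#) := v) ≡.refl (v k))
        push-onlyʳ 1F k = refl
        push-onlyʳ 2F k = reflexive (solve 2 (λ u v →
          u :+ (con 0# :+ ((con 1# :- u :- v) :+ con 0#)) := con 1# :- v :- con 0#)
          ≡.refl (u k) (v k))

        open FinSum M.+-commutativeMonoid using () renaming (fibreSum to fibreSumᴹ)

        -- The fibre of `fuse` over `0F` is the disjoint union of the fibres of `onlyˡ` and `onlyʳ`.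
        split : (f : Fin 3 → ℤ) → fibreSumᴹ Three Three fuse f 0F ≡
                fibreSumᴹ Three Three onlyˡ f 0F + fibreSumᴹ Three Three onlyʳ f 0F
        split f = solve 2 (λ x y →
          x :+ (y :+ con 0#) := (x :+ con 0#) :+ (con 0# :+ (y :+ con 0#))) ≡.refl (f 0F) (f 1F)

      μ′-⊕ : (ww : Idempotent (u ⊕ v)) → μ′ (u ⊕ v) ww M.≈ μ′ u uu + μ′ v vv
      μ′-⊕ ww = M.trans (M.sym (μ′-push t fuse ww _ push-fuse))
        (M.trans (M.reflexive (split (ξ t)))
                 (M.+-cong (μ′-push t onlyˡ uu _ push-onlyˡ) (μ′-push t onlyʳ vv _ push-onlyʳ)))

    -- Along the constant map the fibre sum over `0F` is the total sum, which is 1 for every element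
    -- of `𝒵 M`.
    μ′-𝟏 : (ii : Idempotent 𝟏) → μ′ 𝟏 ii M.≈ 1#
    μ′-𝟏 ii = M.trans
      (M.sym (μ′-push t (λ _ → 0F) ii _ λ
        { 0F k → refl
        ; 1F k → refl
        ; 2F k → refl
        }))
      (proj₂ (Func.to (Ξ.ξ Three) (N , t)))
      where
      t : Triple Three
      t = triple 𝔴𝟏 {𝟏} {𝟎} ii 𝟎-idempotent (⟂-𝟎 𝟏)

    -- Makes `μ′` total, with default value 0 off the idempotent vectors, where the laws of a
    -- measure demand nothing.
    extend : ∀ u → Dec (Idempotent u) → ℤ
    extend u (yes uu) = μ′ u uu
    extend u (no _)   = 0#

    extend-yes : ∀ {u} (u? : Dec (Idempotent u)) (uu : Idempotent u) →
                 extend u u? M.≈ μ′ u uu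
    extend-yes {u} (yes uu′) uu = μ′-cong {u} {u} uu′ uu ≋-refl
    extend-yes     (no ¬uu)  uu = contradiction uu ¬uu

    module _ (idempotent? : ∀ u → Dec (Idempotent u)) where

      μ : Vector → ℤ
      μ u = extend u (idempotent? u)

      μ≈μ′ : ∀ u (uu : Idempotent u) → μ u M.≈ μ′ u uu
      μ≈μ′ u = extend-yes (idempotent? u)

      μ-cong : ∀ {u v} → Idempotent u → u ≋ v → μ u M.≈ μ v
      μ-cong {u} {v} uu u≋v = begin
        μ u       ≈⟨ μ≈μ′ u uu ⟩
        μ′ u uu   ≈⟨ μ′-cong {u} {v} uu vv u≋v ⟩
        μ′ v vv   ≈⟨ μ≈μ′ v vv ⟨
        μ v       ∎
        where
        open SetoidReasoning M.setoid
        vv : Idempotent v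
        vv = trans (𝔴-cong λ k → *-cong (sym (u≋v k)) (sym (u≋v k))) (trans uu (𝔴-cong u≋v))

      μ-⊕ : ∀ {u v} → Idempotent u → Idempotent v → u ⟂ v → μ (u ⊕ v) M.≈ μ u + μ v
      μ-⊕ {u} {v} uu vv u⟂v = begin
        μ (u ⊕ v)            ≈⟨ μ≈μ′ (u ⊕ v) ww ⟩
        μ′ (u ⊕ v) ww        ≈⟨ μ′-⊕ {u} {v} uu vv u⟂v ww ⟩
        μ′ u uu + μ′ v vv    ≈⟨ M.+-cong (μ≈μ′ u uu) (μ≈μ′ v vv) ⟨
        μ u + μ v            ∎
        where
        open SetoidReasoning M.setoid
        ww : Idempotent (u ⊕ v)
        ww = idempotent-⊕ {u} {v} uu vv u⟂v

      μ-𝟏 : μ 𝟏 M.≈ 1#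
      μ-𝟏 = M.trans (μ≈μ′ 𝟏 ii) (μ′-𝟏 ii)
        where
        ii : Idempotent 𝟏
        ii = refl

    measure : OrthogonalMeasure M
    measure = record
      { μ = μ idempotent?
      ; μ-cong = λ {u} {v} → μ-cong idempotent? {u} {v}
      ; μ-⊕ = λ {u} {v} → μ-⊕ idempotent? {u} {v}
      ; μ-𝟏 = μ-𝟏 idempotent?
      }
      where
      idempotent? : ∀ u → Dec (Idempotent u)
      idempotent? u = map′ congruent _≡_[mod_].m∣x-y (+ p ∣? ⟨ u , u ⟩ - 𝔴 u)

-- Arithmetic of odd primes and the contradiction modulo `p ^ 2`.

odd-prime : ∀ {p} → Prime p → 2 < p → ∃ λ k → p ≡ suc (k ℕ.* 2)
odd-prime {p} pr 2<p with p ℕ.% 2 | ℕ.m≡m%n+[m/n]*n p 2 | ℕ.m%n<n p 2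
... | 1 | eq | _ = p ℕ./ 2 , eq
... | 0 | eq | _ with prime⇒irreducible pr (ℕ.divides (p ℕ./ 2) eq)
-- An even prime has the divisor 2, which must be `p` itself.
...   | inj₂ ≡.refl = contradiction 2<p (ℕ.<-irrefl ≡.refl)
odd-prime pr 2<p | suc (suc _) | _ | ℕ.s≤s (ℕ.s≤s ())

hom⇒p≈0 : ∀ q h → h ℤ.+ h ≡ ℤ.1ℤ ℤ.+ + suc q → ∀ {M} →
          MinionHom (𝒱₂-ℤ (suc q)) (𝒵 M) → + suc q ≡ ℤ.0ℤ [mod M ]
hom⇒p≈0 q h 2h≡1+p {M} Ξ = Blocks.p≈0 q h 2h≡1+p {M}
  (FromHom.measure {suc q} {M} Ξ {3 ℕ.+ q ℕ.* 2} (Blocks.𝔴-𝟏 q))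

p²∤p : ∀ {p} → 1 < p → ¬ (p ^ 2 ℕ.∣ p)
p²∤p {p@(suc _)} 1<p p²∣p = ℕ.<⇒≱ (ℕ.m<m*n p p 1<p)
  (ℕ.∣⇒≤ (≡.subst (ℕ._∣ p) (≡.cong (p ℕ.*_) (ℕ.*-identityʳ p)) p²∣p))

≈0⇒∣ : ∀ n m → + n ≡ ℤ.0ℤ [mod m ] → m ℕ.∣ n
≈0⇒∣ n m (congruent d) = ≡.subst (λ i → m ℕ.∣ ℤ.∣ i ∣) (ℤ.+-identityʳ (+ n)) (∣⇒∣ᵤ d)

odd-hom⇒p≈0 : ∀ {p M} → (∃ λ k → p ≡ suc (k ℕ.* 2)) →
              MinionHom (𝒱₂-ℤ p) (𝒵 M) → + p ≡ ℤ.0ℤ [mod M ]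
-- For `p = 2k + 1` the representative of 1/2 is `k + 1`, as twice it is `1 + p`.
odd-hom⇒p≈0 (k , ≡.refl) = hom⇒p≈0 (k ℕ.* 2) (+ suc k) (≡.cong (λ n → + suc n)
  (≡.trans (ℕ.+-suc k k)
    (≡.cong suc (≡.trans (≡.cong (k ℕ.+_) (≡.sym (ℕ.+-identityʳ k))) (ℕ.*-comm 2 k)))))

proposition4p8 : (p : ℕ) → Prime p → 2 < p → ¬ MinionHom (𝒱₂-ℤ p) (𝒵 (p ^ 2))
proposition4p8 p pr 2<p Ξ = p²∤p (ℕ.<-trans (ℕ.n<1+n 1) 2<p)
  (≈0⇒∣ p (p ^ 2) (odd-hom⇒p≈0 {p} {p ^ 2} (odd-prime pr 2<p) Ξ))
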